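{- For every integer $k\ge 3$, we have \[ k!+1 \le f(k) \leq \left(\left\lfloor\frac{k}{2}\right\rfloor+1 \right) k! - \left\lfloor\frac{k}{2}\right\rfloor (k-1)!, \] where $f(k)$ denotes the minimum number of edges in an oriented $k$-graph with Property O.
   Context: An oriented $k$-graph is a pair $\mathcal{H}=(V,\mathcal{E})$, where $V$ is a finite set (the vertex set) and $\mathcal{E}$ (the edge set) is a family of $k$-tuples of elements of $V$ such that no $k$-tuple in $\mathcal{E}$ has a repeated element, and no two $k$-tuples in $\mathcal{E}$ induce the same set (i.e. distinct $k$-tuples in $\mathcal{E}$ have distinct underlying $k$-element subsets of $V$). A tuple $(x_1,x_2,\ldots,x_\ell)$ of distinct elements of $V$ is said to be consistent with a linear order $<$ on $V$ if $x_1<x_2<\cdots<x_\ell$. An oriented $k$-graph $\mathcal{H}=(V,\mathcal{E})$ has Property O if for every linear order $<$ of $V$ there exists an edge $\vec{e}\in\mathcal{E}$ that is consistent with $<$. The function $f$ is defined by \[ f(k) := \min\{|\mathcal{E}| : \text{there exists an oriented } k\text{ -graph } \mathcal{H}=(V,\mathcal{E}) \text{ with Property O}\}, \] the minimum being over oriented $k$-graphs on arbitrary finite vertex sets. -}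

module Defs where

open import Level using (0ℓ; Level)
open import Data.Nat.Base using (ℕ; _≤_)
open import Data.Fin.Base using (Fin)
open import Data.List.Base using (List; length)
import Data.List.Membership.Propositional as List
import Data.List.Relation.Unary.Unique.Propositional as List
open import Data.Vec.Base using (Vec)
import Data.Vec.Membership.Propositional as Vec
import Data.Vec.Relation.Unary.Unique.Propositional as Vec
open import Data.Vec.Relation.Unary.Linked using (Linked)
open import Data.Product.Base using (∃-syntax; _×_)
open import Function.Bundles using (_⇔_)
open import Relation.Binary.Core using (Rel)
open import Relation.Binary.Structures using (IsStrictTotalOrder)
open import Relation.Binary.PropositionalEquality.Core using (_≡_)

SameSet : ∀ {n k} → Vec (Fin n) k → Vec (Fin n) k → Set
SameSet e e′ = ∀ v → (v Vec.∈ e) ⇔ (v Vec.∈ e′)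

-- The vertex set is Fin order, with `order` arbitrary.  The edge set is a
-- duplicate-free list, so that its length is the number of edges.
record OrientedGraph (k : ℕ) : Set where
  field
    order       : ℕ
    edges       : List (Vec (Fin order) k)
    edgesUnique : List.Unique edges
    noRepeats   : ∀ {e} → e List.∈ edges → Vec.Unique e
    setsDiffer  : ∀ {e e′} → e List.∈ edges → e′ List.∈ edges →
                  SameSet e e′ → e ≡ e′

  size : ℕ
  size = length edges

Consistent : ∀ {n k} → Rel (Fin n) 0ℓ → Vec (Fin n) k → Set
Consistent _<_ e = Linked _<_ e

-- IsStrictTotalOrder includes a decision of trichotomy, so the linear orders
-- quantified over here are exactly the decidable ones.
PropertyO : ∀ {k} → OrientedGraph k → Set₁
PropertyO H = (_<_ : Rel (Fin order) 0ℓ) → IsStrictTotalOrder _≡_ _<_ →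
              ∃[ e ] (e List.∈ edges × Consistent _<_ e)
  where open OrientedGraph H

SizeWithPropertyO : ℕ → ℕ → Set₁
SizeWithPropertyO k m =
  ∃[ H ] (OrientedGraph.size {k} H ≡ m × PropertyO H)

IsMin : ∀ {ℓ : Level} → (ℕ → Set ℓ) → ℕ → Set ℓ
IsMin P m = P m × (∀ {m′} → P m′ → m ≤ m′)

-- The graph of the function f: `k f≔ m` says that f(k) is defined as a
-- minimum and equals m.
_f≔_ : ℕ → ℕ → Set₁
k f≔ m = IsMin (SizeWithPropertyO k) m

{-# OPTIONS --safe #-}

-- Lower bound.  Fix Property O and build a linear order greedily from the bottom.  Weight an
-- edge by k! times the probability that it is consistent with a random completion of the
-- current initial segment; averaging over the next vertex preserves the total weight, which
-- is |E| at the start and at least k! at the end, so |E| ≥ k!.  If |E| = k!, then the total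
-- weight is k! for every initial segment.  Take an edge e = (x₁,…,x_k) and the alternating
-- sum, over the subsets of e listed as subsequences of x₂,…,x_k,x₁, of the total weight.  It
-- vanishes.  The contribution of an edge missing some vertex of e also vanishes, whereas e
-- itself contributes 1 - k, a contradiction.
--
-- Upper bound.  Let k = n + 1.  For each permutation c of n base vertices take a pivot vertex
-- v_c and the edge v_c c.  If v_c is instead inserted after the j-th entry of c (1 ≤ j ≤ n),
-- which yields a k-tuple σ, take a filler vertex b_{c,j} and the ⌊k/2⌋ + 1 edges in which b_{c,j}
-- replaces the entry of σ at position 0, 2, 4, … or at the last one: wherever b_{c,j} lies
-- relative to an increasing σ, one of these edges is increasing.
--
-- The minimum is attained constructively because having Property O with m edges is decidable:
-- at most mk vertices matter, so only finitely many graphs and orders need to be searched.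
module Submission where

open import Defs
open import Data.Nat.Base using (ℕ; _+_; _*_; _∸_; _≤_; _!; ⌊_/2⌋)
open import Data.Product.Base using (∃-syntax; _×_)

open import Data.Fin.Base using (Fin; zero; suc; remQuot; combine)
import Data.Fin.Base as Fin
import Data.Fin.Properties as Fin
open import Data.Integer.Base using (ℤ; _-_; 0ℤ) renaming (+_ to pos; _+_ to _+ℤ_; _*_ to _*ℤ_)
import Data.Integer.Properties as ℤ
open import Data.Integer.Tactic.RingSolver using (solve-∀)
open import Data.List.Base using (List; []; _∷_; [_]; _++_; length; filter; map;
  allFin; tabulate; lookup; concat; cartesianProductWith)
import Data.List.Membership.DecPropositional as DecMembership
open import Data.List.Membership.Propositional using (_∈_; _∉_; find; lose)
open import Data.List.Membership.Propositional.Properties using (∈-filter⁺; ∈-++⁺ˡ; ∈-++⁺ʳ;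
  ∈-allFin; ∈-lookup; ∈-tabulate⁻; ∈-map⁺; ∈-map⁻; ∈-concat⁺′; ∈-cartesianProductWith⁺)
open import Data.List.Properties using (filter-notAll; length-++; length-tabulate; length-map)
open import Data.List.Relation.Binary.Subset.Propositional using (_⊆_)
open import Data.List.Relation.Unary.All using (All; []; _∷_)
import Data.List.Relation.Unary.All as All
import Data.List.Relation.Unary.All.Properties as All
open import Data.List.Relation.Unary.AllPairs using (AllPairs; []; _∷_)
open import Data.List.Relation.Unary.Any using (Any; here; there)
import Data.List.Relation.Unary.Any as Any
import Data.List.Relation.Unary.Any.Properties as Any
import Data.List.Relation.Unary.Unique.DecPropositional as DecUnique
open import Data.List.Relation.Unary.Unique.Propositional using (Unique)
import Data.List.Relation.Unary.Unique.Propositional.Properties as Unique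
open import Data.Nat.Base using (zero; suc; _<_; z≤n; s≤s; s≤s⁻¹)
open import Data.Nat.Base using () renaming (_<_ to _<ℕ_)
open import Data.Nat.ListAction using (sum)
open import Data.Nat.Properties hiding (_≟_; _<?_)
import Data.Nat.Tactic.RingSolver as ℕSolver
open import Data.Product.Base using (_,_; proj₁; proj₂)
open import Data.Product.Function.NonDependent.Propositional using (_×-↔_)
open import Data.Sum.Base using (_⊎_; inj₁; inj₂)
open import Data.Sum.Function.Propositional using (_⊎-↔_)
open import Data.Vec.Base using (Vec; []; _∷_; toList; fromList; insertAt; _[_]≔_)
import Data.Vec.Base as Vec
import Data.Vec.Membership.DecPropositional as VecDecMembership
import Data.Vec.Membership.Propositional as Vec
import Data.Vec.Membership.Propositional.Properties as Vec
import Data.Vec.Properties as Vec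
open import Data.Vec.Relation.Unary.All using ([]; _∷_)
import Data.Vec.Relation.Unary.All as VecAll
import Data.Vec.Relation.Unary.All.Properties as VecAll
open import Data.Vec.Relation.Unary.AllPairs using ([]; _∷_)
import Data.Vec.Relation.Unary.AllPairs as VecAllPairs
import Data.Vec.Relation.Unary.Any as VecAny
open import Data.Vec.Relation.Unary.Linked using (Linked; []; [-]; _∷_; linked?)
import Data.Vec.Relation.Unary.Linked as Linked
import Data.Vec.Relation.Unary.Linked.Properties as Linked
import Data.Vec.Relation.Unary.Unique.Propositional as VecUnique
import Data.Vec.Relation.Unary.Unique.Propositional.Properties as VecUnique
open import Algebra.Properties.CommutativeSemigroup +-commutativeSemigroup using (interchange)
open import Function.Base using (_∘_; id; const; case_of_)
open import Function.Bundles using (mk⇔; Equivalence; _↔_; Inverse; Injection)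
open import Function.Properties.Inverse using (↔-refl; ↔-trans; ↔-sym; ↔⇒↣)
open import Level using (0ℓ)
open import Relation.Binary.Core using (Rel)
open import Relation.Binary.Definitions using (DecidableEquality; Transitive; Trichotomous; tri<; tri≈; tri>)
  renaming (Decidable to Decidable₂)
open import Relation.Binary.PropositionalEquality hiding ([_])
open import Relation.Binary.Structures using (IsStrictTotalOrder)
import Relation.Binary.Structures.Biased as Biased
open import Relation.Nullary.Decidable using (Dec; yes; no; ¬?; map′; _×-dec_; _→-dec_; _⊎-dec_)
open import Relation.Nullary.Negation using (¬_; contradiction)

-- Finite sums over lists and averaging.

private
  variable
    I I′ : Set

Σ : List I → (I → ℕ) → ℕ
Σ is g = sum (map g is)

Σ-cong : ∀ (is : List I) {g h : I → ℕ} → (∀ i → g i ≡ h i) → Σ is g ≡ Σ is h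
Σ-cong []       g≗h = refl
Σ-cong (i ∷ is) g≗h = cong₂ _+_ (g≗h i) (Σ-cong is g≗h)

Σ-mono : ∀ (is : List I) {g h : I → ℕ} → (∀ {i} → i ∈ is → g i ≤ h i) → Σ is g ≤ Σ is h
Σ-mono []       g≤h = z≤n
Σ-mono (i ∷ is) g≤h = +-mono-≤ (g≤h (here refl)) (Σ-mono is (g≤h ∘ there))

Σ-const : ∀ (is : List I) c → Σ is (const c) ≡ length is * c
Σ-const []       c = refl
Σ-const (i ∷ is) c = cong (_+_ c) (Σ-const is c)

Σ-+ : ∀ (is : List I) (g h : I → ℕ) → Σ is (λ i → g i + h i) ≡ Σ is g + Σ is h
Σ-+ []       g h = refl
Σ-+ (i ∷ is) g h = trans (cong (_+_ (g i + h i)) (Σ-+ is g h)) (interchange (g i) (h i) _ _)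

Σ-*ˡ : ∀ (is : List I) c (g : I → ℕ) → Σ is (λ i → c * g i) ≡ c * Σ is g
Σ-*ˡ []       c g = sym (*-zeroʳ c)
Σ-*ˡ (i ∷ is) c g = trans (cong (_+_ (c * g i)) (Σ-*ˡ is c g)) (sym (*-distribˡ-+ c (g i) _))

Σ-swap : ∀ (is : List I) (js : List I′) (g : I → I′ → ℕ) →
         Σ is (λ i → Σ js (g i)) ≡ Σ js (λ j → Σ is (λ i → g i j))
Σ-swap []       js g = sym (trans (Σ-const js 0) (*-zeroʳ (length js)))
Σ-swap (i ∷ is) js g = trans (cong (_+_ (Σ js (g i))) (Σ-swap is js g)) (sym (Σ-+ js (g i) _))

-- First-moment argument: if all terms exceeded `c`, each would be at least `suc c` and the sum too
-- large.
Σ≤⇒∃≤ : ∀ (is : List I) (g : I → ℕ) {c} → 0 < length is → Σ is g ≤ length is * c →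
        ∃[ i ] (i ∈ is × g i ≤ c)
Σ≤⇒∃≤ is@(_ ∷ _) g {c} _ Σ≤ with Any.any? (λ i → g i ≤? c) is
... | yes p = find p
... | no ¬p = contradiction (begin-strict
    length is * c       <⟨ *-monoʳ-< (length is) (n<1+n c) ⟩
    length is * suc c   ≡⟨ Σ-const is (suc c) ⟨
    Σ is (const (suc c)) ≤⟨ Σ-mono is (λ i∈ → ≰⇒> (λ gi≤ → ¬p (Any.map (λ { refl → gi≤ }) i∈))) ⟩
    Σ is g              ≤⟨ Σ≤ ⟩
    length is * c       ∎) (<-irrefl refl)
  where open ≤-Reasoning

-- Terms that are all at least their mean leave no slack for any of them to exceed it.
Σ-tight : ∀ (is : List I) (g : I → ℕ) {c} → (∀ {i} → i ∈ is → c ≤ g i) →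
          Σ is g ≤ length is * c → ∀ {i} → i ∈ is → g i ≡ c
Σ-tight (i ∷ is) g {c} c≤g Σ≤ (here refl) = ≤-antisym (+-cancelʳ-≤ (Σ is g) _ _ (begin
    g i + Σ is g         ≤⟨ Σ≤ ⟩
    c + length is * c    ≡⟨ cong (_+_ c) (Σ-const is c) ⟨
    c + Σ is (const c)   ≤⟨ +-monoʳ-≤ c (Σ-mono is (c≤g ∘ there)) ⟩
    c + Σ is g           ∎)) (c≤g (here refl))
  where open ≤-Reasoning
Σ-tight (i ∷ is) g {c} c≤g Σ≤ (there i∈) = Σ-tight is g (c≤g ∘ there) (+-cancelˡ-≤ c _ _ (begin
    c + Σ is g         ≤⟨ +-monoˡ-≤ (Σ is g) (c≤g (here refl)) ⟩
    g i + Σ is g       ≤⟨ Σ≤ ⟩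
    c + length is * c  ∎)) i∈
  where open ≤-Reasoning

𝟙 : ∀ {P : Set} → Dec P → ℕ
𝟙 (yes _) = 1
𝟙 (no  _) = 0

𝟙≤1 : ∀ {P : Set} (P? : Dec P) → 𝟙 P? ≤ 1
𝟙≤1 (yes _) = ≤-refl
𝟙≤1 (no  _) = z≤n

-- Weight of a tuple relative to an initial segment.

module Prefix {A : Set} (_≟_ : DecidableEquality A) where

  open DecMembership _≟_ using (_∈?_)

  private
    variable
      R : List A

  Σ-𝟙-≟ : ∀ {x} → Unique R → x ∈ R → Σ R (λ v → 𝟙 (v ≟ x)) ≡ 1
  Σ-𝟙-≟ {R = r ∷ R} {x} (r∉R ∷ uR) x∈ with r ≟ x
  ... | yes refl = cong suc (zeros R r∉R)
    where
    zeros : ∀ R → All (r ≢_) R → Σ R (λ v → 𝟙 (v ≟ r)) ≡ 0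
    zeros []      []          = refl
    zeros (s ∷ R) (r≢s ∷ r∉R) with s ≟ r
    ... | yes s≡r = contradiction (sym s≡r) r≢s
    ... | no _    = zeros R r∉R
  Σ-𝟙-≟ (r∉R ∷ uR) (here refl) | no r≢x = contradiction refl r≢x
  Σ-𝟙-≟ (r∉R ∷ uR) (there x∈)  | no r≢x = Σ-𝟙-≟ uR x∈

  𝟙-∈-∷ : ∀ {x xs} → x ∉ xs → ∀ v → 𝟙 (v ∈? (x ∷ xs)) ≡ 𝟙 (v ≟ x) + 𝟙 (v ∈? xs)
  𝟙-∈-∷ {x} {xs} x∉xs v with v ≟ x | v ∈? xs
  ... | yes refl | yes v∈ = contradiction v∈ x∉xs
  ... | yes _    | no  _  = refl
  ... | no  _    | yes _  = refl
  ... | no  _    | no  _  = refl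

  Σ-𝟙-∈ : ∀ {xs} → Unique R → Unique xs → xs ⊆ R → Σ R (λ v → 𝟙 (v ∈? xs)) ≡ length xs
  Σ-𝟙-∈ {R} {[]}     uR _ _ = trans (Σ-const R 0) (*-zeroʳ (length R))
  Σ-𝟙-∈ {R} {x ∷ xs} uR uxs@(_ ∷ uxs′) xs⊆R = begin
    Σ R (λ v → 𝟙 (v ∈? (x ∷ xs)))                      ≡⟨ Σ-cong R (𝟙-∈-∷ (Unique.Unique[x∷xs]⇒x∉xs uxs)) ⟩
    Σ R (λ v → 𝟙 (v ≟ x) + 𝟙 (v ∈? xs))                ≡⟨ Σ-+ R _ _ ⟩
    Σ R (λ v → 𝟙 (v ≟ x)) + Σ R (λ v → 𝟙 (v ∈? xs))
      ≡⟨ cong₂ _+_ (Σ-𝟙-≟ uR (xs⊆R (here refl))) (Σ-𝟙-∈ uR uxs′ (xs⊆R ∘ there)) ⟩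
    suc (length xs) ∎
    where open ≡-Reasoning

  unique-⊆⇒length≤ : ∀ {xs ys} → Unique xs → Unique ys → xs ⊆ ys → length xs ≤ length ys
  unique-⊆⇒length≤ {xs} {ys} uxs uys xs⊆ys = begin
    length xs                   ≡⟨ Σ-𝟙-∈ uys uxs xs⊆ys ⟨
    Σ ys (λ v → 𝟙 (v ∈? xs))    ≤⟨ Σ-mono ys (λ {v} _ → 𝟙≤1 (v ∈? xs)) ⟩
    Σ ys (const 1)              ≡⟨ trans (Σ-const ys 1) (*-identityʳ _) ⟩
    length ys                   ∎
    where open ≤-Reasoning

  -- An element of `ys` outside `xs` could be put in front of `xs`, giving a duplicate-free list
  -- inside `ys` that is longer than `ys`.
  unique-⊆⇒⊇ : ∀ {xs ys} → Unique xs → Unique ys → length xs ≡ length ys → xs ⊆ ys → ys ⊆ xs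
  unique-⊆⇒⊇ {xs} uxs uys len xs⊆ys {y} y∈ys with y ∈? xs
  ... | yes y∈xs = y∈xs
  ... | no  y∉xs = contradiction
    (unique-⊆⇒length≤ (All.¬Any⇒All¬ xs y∉xs ∷ uxs) uys
      (λ { (here refl) → y∈ys ; (there x∈) → xs⊆ys x∈ }))
    (≤⇒≯ (≤-reflexive (sym len)))

  -- The ratio for `w` when `v` is placed next: the head of the tuple is the favourable choice, a
  -- later entry makes consistency impossible, and an outside element changes nothing.
  factor : A → List A → ℕ
  factor v []       = 1
  factor v (x ∷ xs) with v ≟ x | v ∈? xs
  ... | yes _ | _     = suc (length xs)
  ... | no _  | yes _ = 0
  ... | no _  | no _  = 1

  -- The entries still to be placed. When `v` lies in the tail, `factor` is already 0, and the
  -- default `[]` keeps uniqueness, inclusion in the tuple and absence of `v`.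
  rem : A → List A → List A
  rem v []       = []
  rem v (x ∷ xs) with v ≟ x | v ∈? xs
  ... | yes _ | _     = xs
  ... | no _  | yes _ = []
  ... | no _  | no _  = x ∷ xs

  -- |f|! times the probability that f is consistent with a uniformly random
  -- linear order, conditioned on p being its initial segment.
  w : List A → List A → ℕ
  w f []      = 1
  w f (v ∷ p) = factor v f * w (rem v f) p

  -- The three cases of `factor` in one linear formula; the indicator of the tail stands on the left
  -- so that nothing is subtracted in ℕ.
  factor-identity : ∀ {x xs} → x ∉ xs → ∀ v →
    factor v (x ∷ xs) + 𝟙 (v ∈? xs) ≡ length xs * 𝟙 (v ≟ x) + 1
  factor-identity {x} {xs} x∉xs v with v ≟ x | v ∈? xs
  ... | yes refl | yes v∈ = contradiction v∈ x∉xs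
  ... | yes _    | no  _  = trans (+-identityʳ _)
    (trans (+-comm 1 (length xs)) (cong (_+ 1) (sym (*-identityʳ (length xs)))))
  ... | no  _    | yes _  = cong (_+ 1) (sym (*-zeroʳ (length xs)))
  ... | no  _    | no  _  = cong (_+ 1) (sym (*-zeroʳ (length xs)))

  -- The mean factor is 1: relative to 1, the head gains `length xs`, while each of the `length xs`
  -- later entries loses 1.
  Σ-factor : ∀ {f} → Unique R → Unique f → f ⊆ R → Σ R (λ v → factor v f) ≡ length R
  Σ-factor {R} {[]}     uR uf f⊆R = trans (Σ-const R 1) (*-identityʳ _)
  Σ-factor {R} {x ∷ xs} uR uf@(_ ∷ uxs) f⊆R = +-cancelʳ-≡ (length xs) _ _ (begin
    Σ R (λ v → factor v (x ∷ xs)) + length xs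
      ≡⟨ cong (_+_ (Σ R (λ v → factor v (x ∷ xs)))) (Σ-𝟙-∈ uR uxs (f⊆R ∘ there)) ⟨
    Σ R (λ v → factor v (x ∷ xs)) + Σ R (λ v → 𝟙 (v ∈? xs))
      ≡⟨ Σ-+ R _ _ ⟨
    Σ R (λ v → factor v (x ∷ xs) + 𝟙 (v ∈? xs))
      ≡⟨ Σ-cong R (factor-identity (Unique.Unique[x∷xs]⇒x∉xs uf)) ⟩
    Σ R (λ v → length xs * 𝟙 (v ≟ x) + 1)
      ≡⟨ Σ-+ R _ _ ⟩
    Σ R (λ v → length xs * 𝟙 (v ≟ x)) + Σ R (const 1)
      ≡⟨ cong₂ _+_ (Σ-*ˡ R (length xs) _) (trans (Σ-const R 1) (*-identityʳ _)) ⟩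
    length xs * Σ R (λ v → 𝟙 (v ≟ x)) + length R
      ≡⟨ cong (λ z → length xs * z + length R) (Σ-𝟙-≟ uR (f⊆R (here refl))) ⟩
    length xs * 1 + length R
      ≡⟨ trans (cong (_+ length R) (*-identityʳ _)) (+-comm (length xs) _) ⟩
    length R + length xs ∎)
    where open ≡-Reasoning

  rem-unique : ∀ v {f} → Unique f → Unique (rem v f)
  rem-unique v {[]}     uf = uf
  rem-unique v {x ∷ xs} (x∉ ∷ uxs) with v ≟ x | v ∈? xs
  ... | yes _ | _     = uxs
  ... | no _  | yes _ = []
  ... | no _  | no _  = x∉ ∷ uxs

  rem-⊆ : ∀ v f → rem v f ⊆ f
  rem-⊆ v []       = id
  rem-⊆ v (x ∷ xs) with v ≟ x | v ∈? xs
  ... | yes _ | _     = there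
  ... | no _  | yes _ = λ ()
  ... | no _  | no _  = id

  ∉-rem : ∀ v {f} → Unique f → v ∉ rem v f
  ∉-rem v {[]}     uf ()
  ∉-rem v {x ∷ xs} uf with v ≟ x | v ∈? xs
  ... | yes refl | _      = Unique.Unique[x∷xs]⇒x∉xs uf
  ... | no _     | yes _  = λ ()
  ... | no v≢x   | no v∉ = λ { (here v≡x) → v≢x v≡x ; (there v∈) → v∉ v∈ }

  delete : A → List A → List A
  delete v = filter (λ u → ¬? (v ≟ u))

  delete-length : ∀ {v} → v ∈ R → length (delete v R) < length R
  delete-length v∈R = filter-notAll _ _ (Any.map (λ v≡u v≢u → v≢u v≡u) v∈R)

  delete-unique : ∀ v → Unique R → Unique (delete v R)
  delete-unique v = Unique.filter⁺ (λ u → ¬? (v ≟ u))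

  ⊆-delete : ∀ {v f} → v ∉ f → f ⊆ R → f ⊆ delete v R
  ⊆-delete {v = v} v∉f f⊆R {u} u∈f = ∈-filter⁺ _ (f⊆R u∈f) (λ { refl → v∉f u∈f })

  delete-⊆ : ∀ {v p} → delete v R ⊆ p → R ⊆ v ∷ p
  delete-⊆ {v = v} dR⊆p {u} u∈R with v ≟ u
  ... | yes refl = here refl
  ... | no  v≢u  = there (dR⊆p (∈-filter⁺ _ u∈R v≢u))

  module _ (is : List I) where

    -- The coefficients collect the factors of the vertices already placed, so that placing one more
    -- vertex gives a sum of the same form.
    W : (c : I → ℕ) (f : I → List A) → List A → ℕ
    W c f p = Σ is (λ i → c i * w (f i) p)

    W-∷ : ∀ c f v p → W c f (v ∷ p) ≡ W (λ i → c i * factor v (f i)) (rem v ∘ f) p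
    W-∷ c f v p = Σ-cong is (λ i → sym (*-assoc (c i) (factor v (f i)) _))

    W-[-] : ∀ c f v → W c f [ v ] ≡ W (λ i → c i * factor v (f i)) (rem v ∘ f) []
    W-[-] c f v = W-∷ c f v []

    Within : List A → (I → List A) → Set
    Within R f = ∀ i → Unique (f i) × f i ⊆ R

    rem-within : ∀ {f} v → Within R f → Within (delete v R) (rem v ∘ f)
    rem-within {f = f} v f! i = let uf , f⊆R = f! i in
      rem-unique v uf , ⊆-delete (∉-rem v uf) (f⊆R ∘ rem-⊆ v (f i))

    -- By linearity from `Σ-factor`: the total weight is a martingale under a uniformly random next
    -- vertex.
    Σ-W : ∀ {f} c → Unique R → Within R f → Σ R (λ v → W c f [ v ]) ≡ length R * W c f []
    Σ-W {R} {f} c uR f! = begin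
      Σ R (λ v → Σ is (λ i → c i * (factor v (f i) * 1)))  ≡⟨ Σ-swap R is _ ⟩
      Σ is (λ i → Σ R (λ v → c i * (factor v (f i) * 1)))  ≡⟨ Σ-cong is inner ⟩
      Σ is (λ i → length R * (c i * 1))                    ≡⟨ Σ-*ˡ is (length R) _ ⟩
      length R * W c f [] ∎
      where
      open ≡-Reasoning
      inner : ∀ i → Σ R (λ v → c i * (factor v (f i) * 1)) ≡ length R * (c i * 1)
      inner i = begin
        Σ R (λ v → c i * (factor v (f i) * 1)) ≡⟨ Σ-*ˡ R (c i) _ ⟩
        c i * Σ R (λ v → factor v (f i) * 1)   ≡⟨ cong (c i *_) (Σ-cong R (λ v → *-identityʳ _)) ⟩
        c i * Σ R (λ v → factor v (f i))       ≡⟨ cong (c i *_) (Σ-factor uR (proj₁ (f! i)) (proj₂ (f! i))) ⟩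
        c i * length R                         ≡⟨ *-comm (c i) (length R) ⟩
        length R * c i                         ≡⟨ cong (length R *_) (*-identityʳ (c i)) ⟨
        length R * (c i * 1)                   ∎

    -- By `Σ-W` some next vertex does not raise the total; choosing such a vertex each time exhausts
    -- `R`. The bound `r` on the length makes the recursion structural.
    extend : ∀ r R {f} c → length R ≤ r → Unique R → Within R f →
             ∃[ p ] (R ⊆ p × W c f p ≤ W c f [])
    extend r       []        c _ uR f! = [] , id , ≤-refl
    extend (suc r) R@(_ ∷ _) {f} c len uR f! =
      let v , v∈R , Wv≤ = Σ≤⇒∃≤ R (λ v → W c f [ v ]) (s≤s z≤n) (≤-reflexive (Σ-W c uR f!))
          p , dR⊆p , Wp≤ = extend r (delete v R) (λ i → c i * factor v (f i))
                             (≤-trans (s≤s⁻¹ (delete-length v∈R)) (s≤s⁻¹ len))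
                             (delete-unique v uR) (rem-within v f!)
      in v ∷ p , delete-⊆ dR⊆p , (begin
        W c f (v ∷ p) ≡⟨ W-∷ c f v p ⟩
        _             ≤⟨ Wp≤ ⟩
        _             ≡⟨ W-[-] c f v ⟨
        W c f [ v ]   ≤⟨ Wv≤ ⟩
        W c f []      ∎)
      where open ≤-Reasoning

    module _ {K : ℕ} where

      Bounded : List A → (I → ℕ) → (I → List A) → Set
      Bounded R c f = ∀ {p} → R ⊆ p → K ≤ W c f p

      bounded-∷ : ∀ c f v → Bounded R c f →
                  Bounded (delete v R) (λ i → c i * factor v (f i)) (rem v ∘ f)
      bounded-∷ c f v bd {p} dR⊆p = subst (K ≤_) (W-∷ c f v p) (bd (delete-⊆ dR⊆p))

      -- The greedy completion does not raise the total, yet ends at `K` or more.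
      bounded-[] : ∀ c f → Unique R → Within R f → Bounded R c f → K ≤ W c f []
      bounded-[] {R} c f uR f! bd =
        let p , R⊆p , Wp≤ = extend (length R) R c ≤-refl uR f! in ≤-trans (bd R⊆p) Wp≤

      -- By `bounded-[]`, every choice of next vertex leaves at least `K`; the mean of these totals
      -- is `K`, so each equals `K`, and the argument repeats along `q`.
      W-tight : ∀ c f q → Unique R → Within R f → Bounded R c f → W c f [] ≡ K →
                Unique q → q ⊆ R → W c f q ≡ K
      W-tight c f []      uR f! bd W≡K uq q⊆R = W≡K
      W-tight {R} c f (v ∷ q) uR f! bd W≡K uq@(_ ∷ uq′) q⊆R =
        trans (W-∷ c f v q) (W-tight (λ i → c i * factor v (f i)) (rem v ∘ f) q (delete-unique v uR) (rem-within v f!)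
          (bounded-∷ c f v bd) (trans (sym (W-[-] c f v)) Wv≡K) uq′
          (⊆-delete (Unique.Unique[x∷xs]⇒x∉xs uq) (q⊆R ∘ there)))
        where
        Wv≡K : W c f [ v ] ≡ K
        Wv≡K = Σ-tight R (λ v → W c f [ v ])
          (λ {u} _ → subst (K ≤_) (sym (W-[-] c f u))
            (bounded-[] (λ i → c i * factor u (f i)) (rem u ∘ f)
              (delete-unique u uR) (rem-within u f!) (bounded-∷ c f u bd)))
          (≤-reflexive (trans (Σ-W c uR f!) (cong (length R *_) W≡K)))
          (q⊆R (here refl))

  -- Alternating sums over subsequences.

  -- Σ over the subsequences s of xs of (-1)^|s| g s.
  alt : List A → (List A → ℤ) → ℤ
  alt []       g = g []
  alt (x ∷ xs) g = alt xs g - alt xs (λ p → g (x ∷ p))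

  alt-cong : ∀ xs {g h} → (∀ p → g p ≡ h p) → alt xs g ≡ alt xs h
  alt-cong []       g≗h = g≗h []
  alt-cong (x ∷ xs) g≗h = cong₂ _-_ (alt-cong xs g≗h) (alt-cong xs (λ p → g≗h (x ∷ p)))

  -- Needed because total weights are known only along duplicate-free prefixes; subsequences of a
  -- duplicate-free list are such prefixes.
  alt-unique-cong : ∀ {xs g h} → Unique xs →
                    (∀ p → Unique p → p ⊆ xs → g p ≡ h p) → alt xs g ≡ alt xs h
  alt-unique-cong {[]}     uxs g≗h = g≗h [] [] id
  alt-unique-cong {x ∷ xs} uxs@(_ ∷ uxs′) g≗h = cong₂ _-_
    (alt-unique-cong uxs′ (λ p up p⊆ → g≗h p up (there ∘ p⊆)))
    (alt-unique-cong uxs′ (λ p up p⊆ → g≗h (x ∷ p)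
      (All.¬Any⇒All¬ p (Unique.Unique[x∷xs]⇒x∉xs uxs ∘ p⊆) ∷ up)
      (λ { (here refl) → here refl ; (there u∈) → there (p⊆ u∈) })))

  alt-+ : ∀ xs g h → alt xs (λ p → g p +ℤ h p) ≡ alt xs g +ℤ alt xs h
  alt-+ []       g h = refl
  alt-+ (x ∷ xs) g h = trans (cong₂ _-_ (alt-+ xs g h) (alt-+ xs _ _))
    (rearrange (alt xs g) (alt xs h) _ _)
    where
    rearrange : ∀ a b c d → (a +ℤ b) - (c +ℤ d) ≡ (a - c) +ℤ (b - d)
    rearrange = solve-∀

  alt-*ˡ : ∀ xs c g → alt xs (λ p → c *ℤ g p) ≡ c *ℤ alt xs g
  alt-*ˡ []       c g = refl
  alt-*ˡ (x ∷ xs) c g = trans (cong₂ _-_ (alt-*ˡ xs c g) (alt-*ˡ xs c _))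
    (factorise c (alt xs g) _)
    where
    factorise : ∀ a b c → a *ℤ b - a *ℤ c ≡ a *ℤ (b - c)
    factorise = solve-∀

  alt-0 : ∀ xs → alt xs (const 0ℤ) ≡ 0ℤ
  alt-0 []       = refl
  alt-0 (x ∷ xs) = ℤ.+-inverseʳ (alt xs (const 0ℤ))

  alt-const : ∀ x xs c → alt (x ∷ xs) (const c) ≡ 0ℤ
  alt-const x xs c = ℤ.+-inverseʳ (alt xs (const c))

  altw : List A → List A → ℤ
  altw xs f = alt xs (λ p → pos (w f p))

  alt-w-∷ : ∀ xs x f → alt xs (λ p → pos (w f (x ∷ p))) ≡ pos (factor x f) *ℤ altw xs (rem x f)
  alt-w-∷ xs x f = trans (alt-cong xs (λ p → ℤ.pos-* (factor x f) (w (rem x f) p)))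
    (alt-*ˡ xs (pos (factor x f)) (λ p → pos (w (rem x f) p)))

  factor-∉ : ∀ {y} f → y ∉ f → factor y f ≡ 1
  factor-∉ []       _  = refl
  factor-∉ {y} (x ∷ xs) y∉ with y ≟ x | y ∈? xs
  ... | yes y≡x | _      = contradiction (here y≡x) y∉
  ... | no _    | yes y∈ = contradiction (there y∈) y∉
  ... | no _    | no _   = refl

  rem-∉ : ∀ {y} f → y ∉ f → rem y f ≡ f
  rem-∉ []       _  = refl
  rem-∉ {y} (x ∷ xs) y∉ with y ≟ x | y ∈? xs
  ... | yes y≡x | _      = contradiction (here y≡x) y∉
  ... | no _    | yes y∈ = contradiction (there y∈) y∉
  ... | no _    | no _   = refl

  -- Subsequences with and without y cancel in pairs.
  altw-∉ : ∀ {y xs} f → y ∈ xs → y ∉ f → altw xs f ≡ 0ℤ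
  altw-∉ {y} {x ∷ xs} f (here refl) y∉f = begin
    altw xs f - alt xs (λ p → pos (w f (y ∷ p)))          ≡⟨ cong (λ z → altw xs f - z) (alt-w-∷ xs y f) ⟩
    altw xs f - pos (factor y f) *ℤ altw xs (rem y f)
      ≡⟨ cong₂ (λ a g → altw xs f - pos a *ℤ altw xs g) (factor-∉ f y∉f) (rem-∉ f y∉f) ⟩
    altw xs f - pos 1 *ℤ altw xs f                      ≡⟨ cong (λ z → altw xs f - z) (ℤ.*-identityˡ _) ⟩
    altw xs f - altw xs f                             ≡⟨ ℤ.+-inverseʳ (altw xs f) ⟩
    0ℤ ∎
    where open ≡-Reasoning
  altw-∉ {y} {x ∷ xs} f (there y∈) y∉f = begin
    altw xs f - alt xs (λ p → pos (w f (x ∷ p)))          ≡⟨ cong (λ z → altw xs f - z) (alt-w-∷ xs x f) ⟩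
    altw xs f - pos (factor x f) *ℤ altw xs (rem x f)
      ≡⟨ cong₂ (λ a b → a - pos (factor x f) *ℤ b)
           (altw-∉ f y∈ y∉f) (altw-∉ (rem x f) y∈ (y∉f ∘ rem-⊆ x f)) ⟩
    0ℤ - pos (factor x f) *ℤ 0ℤ                           ≡⟨ cong (λ z → 0ℤ - z) (ℤ.*-zeroʳ (pos (factor x f))) ⟩
    0ℤ ∎
    where open ≡-Reasoning

  -- With the first vertex of f moved to the end, only the subsequences [] and [ x ] contribute.
  altw-rotate : ∀ {x xs} ys → Unique (x ∷ xs) → ys ⊆ xs →
                altw (ys ++ [ x ]) (x ∷ xs) ≡ pos 1 - pos (suc (length xs))
  altw-rotate {x} {xs} [] uf _ with x ≟ x
  ... | yes _  = cong (λ z → pos 1 - pos z) (*-identityʳ (suc (length xs)))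
  ... | no x≢x = contradiction refl x≢x
  altw-rotate {x} {xs} (y ∷ ys) uf ys⊆xs = begin
    altw (ys ++ [ x ]) (x ∷ xs) - alt (ys ++ [ x ]) (λ p → pos (w (x ∷ xs) (y ∷ p)))
      ≡⟨ cong₂ _-_ (altw-rotate ys uf (ys⊆xs ∘ there))
           (trans (alt-w-∷ (ys ++ [ x ]) y (x ∷ xs))
             (cong (λ a → pos a *ℤ altw (ys ++ [ x ]) (rem y (x ∷ xs))) vanishes)) ⟩
    (pos 1 - pos (suc (length xs))) - pos 0 *ℤ altw (ys ++ [ x ]) (rem y (x ∷ xs))
      ≡⟨ trans (cong (λ z → (pos 1 - pos (suc (length xs))) - z)
                     (ℤ.*-zeroˡ (altw (ys ++ [ x ]) (rem y (x ∷ xs)))))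
               (ℤ.+-identityʳ _) ⟩
    pos 1 - pos (suc (length xs)) ∎
    where
    open ≡-Reasoning
    -- A tail entry placed ahead of the head `x` rules out consistency.
    vanishes : factor y (x ∷ xs) ≡ 0
    vanishes with y ≟ x | y ∈? xs
    ... | yes refl | _     = contradiction (ys⊆xs (here refl)) (Unique.Unique[x∷xs]⇒x∉xs uf)
    ... | no _     | yes _ = refl
    ... | no _     | no y∉ = contradiction (ys⊆xs (here refl)) y∉

  altΣw-∷ : ∀ xs i (is : List I) (f : I → List A) →
            alt xs (λ p → pos (W (i ∷ is) (const 1) f p)) ≡
            altw xs (f i) +ℤ alt xs (λ p → pos (W is (const 1) f p))
  altΣw-∷ xs i is f = trans
    (alt-cong xs (λ p → trans
      (cong (λ z → pos (z + W is (const 1) f p)) (*-identityˡ (w (f i) p)))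
      (ℤ.pos-+ (w (f i) p) (W is (const 1) f p))))
    (alt-+ xs (λ p → pos (w (f i) p)) (λ p → pos (W is (const 1) f p)))

  altΣw-0 : ∀ xs (is : List I) (f : I → List A) → (∀ {i} → i ∈ is → altw xs (f i) ≡ 0ℤ) →
            alt xs (λ p → pos (W is (const 1) f p)) ≡ 0ℤ
  altΣw-0 xs []       f zeros = alt-0 xs
  altΣw-0 xs (i ∷ is) f zeros = trans (altΣw-∷ xs i is f)
    (cong₂ _+ℤ_ (zeros (here refl)) (altΣw-0 xs is f (zeros ∘ there)))

  -- The order in which a list presents its elements.

  -- The index of the first occurrence; an absent element gets the default `length p`.
  position : List A → A → ℕ
  position []      u = 0
  position (v ∷ p) u with v ≟ u
  ... | yes _ = 0
  ... | no  _ = suc (position p u)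

  position-here : ∀ v p → position (v ∷ p) v ≡ 0
  position-here v p with v ≟ v
  ... | yes _  = refl
  ... | no v≢v = contradiction refl v≢v

  position-there : ∀ {v u} p → v ≢ u → position (v ∷ p) u ≡ suc (position p u)
  position-there {v} {u} p v≢u with v ≟ u
  ... | yes v≡u = contradiction v≡u v≢u
  ... | no _    = refl

  position-injective : ∀ p {u v} → u ∈ p → v ∈ p → position p u ≡ position p v → u ≡ v
  position-injective (x ∷ p) {u} {v} u∈ v∈ eq with x ≟ u | x ≟ v
  ... | yes refl | yes refl = refl
  ... | no x≢u   | no x≢v   = position-injective p (∈-tail x≢u u∈) (∈-tail x≢v v∈) (suc-injective eq)
    where
    ∈-tail : ∀ {x y} {p : List A} → x ≢ y → y ∈ x ∷ p → y ∈ p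
    ∈-tail x≢y (here refl) = contradiction refl x≢y
    ∈-tail x≢y (there y∈)  = y∈

  Before : List A → A → A → Set
  Before p u v = position p u < position p v

  w-[] : ∀ p → w [] p ≡ 1
  w-[] []      = refl
  w-[] (v ∷ p) = trans (*-identityˡ (w [] p)) (w-[] p)

  before-∷⁻ : ∀ {v p e} → v ∉ e → AllPairs (Before (v ∷ p)) e → AllPairs (Before p) e
  before-∷⁻ v∉ [] = []
  before-∷⁻ {v} {p} v∉ (u< ∷ e!) =
    All.tabulate (λ {y} y∈ → s≤s⁻¹ (subst₂ _<_ (position-there p (λ { refl → v∉ (here refl) }))
                                          (position-there p (λ { refl → v∉ (there y∈) }))
                                          (All.lookup u< y∈)))
    ∷ before-∷⁻ (v∉ ∘ there) e!

  factor-here : ∀ x xs → factor x (x ∷ xs) ≡ suc (length xs)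
  factor-here x xs with x ≟ x
  ... | yes _  = refl
  ... | no x≢x = contradiction refl x≢x

  rem-here : ∀ x xs → rem x (x ∷ xs) ≡ xs
  rem-here x xs with x ≟ x
  ... | yes _  = refl
  ... | no x≢x = contradiction refl x≢x

  ⊆-∷⁻ : ∀ {v} {f p : List A} → v ∉ f → f ⊆ v ∷ p → f ⊆ p
  ⊆-∷⁻ v∉f f⊆ u∈ with f⊆ u∈
  ... | here refl = contradiction u∈ v∉f
  ... | there u∈p = u∈p

  -- Entries of `f` are met in their own order, so each factor is 1 or the number of entries still
  -- left, and these numbers multiply to the factorial.
  w-consistent : ∀ {f} p → Unique f → f ⊆ p → AllPairs (Before p) f → w f p ≡ length f !
  w-consistent {[]}     p       _  _   _ = w-[] p
  w-consistent {x ∷ xs} []      _  f⊆p _ = contradiction (f⊆p (here refl)) λ ()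
  w-consistent {x ∷ xs} (v ∷ p) uf@(_ ∷ uxs) f⊆p f<@(x< ∷ xs<) = case v ∈? (x ∷ xs) of λ where
    (yes (here refl)) →
      let x∉xs = Unique.Unique[x∷xs]⇒x∉xs uf in
      cong₂ _*_ (factor-here x xs) (trans (cong (λ f → w f p) (rem-here x xs))
        (w-consistent p uxs (⊆-∷⁻ x∉xs (f⊆p ∘ there)) (before-∷⁻ x∉xs xs<)))
    -- A later entry at the front of the prefix has position 0, which leaves no room for `x` before
    -- it.
    (yes (there v∈)) →
      contradiction (subst (position (v ∷ p) x <_) (position-here v p) (All.lookup x< v∈)) λ ()
    (no v∉) → trans
      (cong₂ (λ a f → a * w f p) (factor-∉ (x ∷ xs) v∉) (rem-∉ (x ∷ xs) v∉))
      (trans (*-identityˡ _) (w-consistent p uf (⊆-∷⁻ v∉ f⊆p) (before-∷⁻ v∉ f<)))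

-- Linear orders from keys, and conversions from vectors to lists.

-- Ties are broken by index, so that an arbitrary key function yields a linear order.
Lex : ∀ {A : Set} {n} → Rel A 0ℓ → (Fin n → A) → Rel (Fin n) 0ℓ
Lex _<_ key u v = key u < key v ⊎ (key u ≡ key v × u Fin.< v)

Lex-isStrictTotalOrder : ∀ {A : Set} {n} {_<_ : Rel A 0ℓ} → IsStrictTotalOrder _≡_ _<_ →
                         (key : Fin n → A) → IsStrictTotalOrder _≡_ (Lex _<_ key)
Lex-isStrictTotalOrder {n = n} {_<_ = _<_} sto key = isStrictTotalOrderᶜ record
  { isEquivalence = isEquivalence
  ; trans         = transitive
  ; compare       = trichotomous
  }
  where
  open Biased (_≡_ {A = Fin n}) using (isStrictTotalOrderᶜ)
  open IsStrictTotalOrder sto using (irrefl; asym; compare) renaming (trans to <-trans′)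
  transitive : Transitive (Lex _<_ key)
  transitive (inj₁ u<v)         (inj₁ v<w)         = inj₁ (<-trans′ u<v v<w)
  transitive {i = u} (inj₁ u<v) (inj₂ (v≡w , _))   = inj₁ (subst (key u <_) v≡w u<v)
  transitive {k = w} (inj₂ (u≡v , _)) (inj₁ v<w)   = inj₁ (subst (_< key w) (sym u≡v) v<w)
  transitive (inj₂ (u≡v , u<v)) (inj₂ (v≡w , v<w)) = inj₂ (trans u≡v v≡w , Fin.<-trans u<v v<w)
  trichotomous : Trichotomous _≡_ (Lex _<_ key)
  trichotomous u v with compare (key u) (key v)
  ... | tri< <₁ ≢₁ ≯₁ = tri< (inj₁ <₁) (λ { refl → ≢₁ refl }) λ { (inj₁ >₁) → ≯₁ >₁ ; (inj₂ (≡₁ , _)) → ≢₁ (sym ≡₁) }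
  ... | tri> ≮₁ ≢₁ >₁ = tri> (λ { (inj₁ <₁) → ≮₁ <₁ ; (inj₂ (≡₁ , _)) → ≢₁ ≡₁ }) (λ { refl → ≢₁ refl }) (inj₁ >₁)
  ... | tri≈ ≮₁ ≡₁ ≯₁ with Fin.<-cmp u v
  ...   | tri< <₂ ≢₂ ≯₂ = tri< (inj₂ (≡₁ , <₂)) ≢₂ λ { (inj₁ >₁) → ≯₁ >₁ ; (inj₂ (_ , >₂)) → ≯₂ >₂ }
  ...   | tri≈ ≮₂ ≡₂ ≯₂ = tri≈ (λ { (inj₁ <₁) → ≮₁ <₁ ; (inj₂ (_ , <₂)) → ≮₂ <₂ }) ≡₂
                                λ { (inj₁ >₁) → ≯₁ >₁ ; (inj₂ (_ , >₂)) → ≯₂ >₂ }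
  ...   | tri> ≮₂ ≢₂ >₂ = tri> (λ { (inj₁ <₁) → ≮₁ <₁ ; (inj₂ (_ , <₂)) → ≮₂ <₂ }) ≢₂ (inj₂ (sym ≡₁ , >₂))

toList-linked : ∀ {A : Set} {R : Rel A 0ℓ} {n} {xs : Vec A n} → Transitive R →
                Linked R xs → AllPairs R (toList xs)
toList-linked trans []           = []
toList-linked trans [-]          = [] ∷ []
toList-linked trans (Rxy ∷ Rxs) = VecAll.toList⁺ (Linked.Linked⇒All trans Rxy Rxs) ∷ toList-linked trans Rxs

toList-unique : ∀ {A : Set} {n} {xs : Vec A n} → VecUnique.Unique xs → Unique (toList xs)
toList-unique VecUnique.[]         = []
toList-unique (x∉ VecUnique.∷ uxs) = VecAll.toList⁺ x∉ ∷ toList-unique uxs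

rotate-unique : ∀ {A : Set} {x : A} {xs} → Unique (x ∷ xs) → Unique (xs ++ [ x ])
rotate-unique {x = x} {xs} uf@(_ ∷ uxs) = Unique.++⁺ uxs ([] ∷ [])
  λ { (u∈xs , here refl) → Unique.Unique[x∷xs]⇒x∉xs uf u∈xs }

∈⇒≤Σ : ∀ {is : List I} {i} (g : I → ℕ) → i ∈ is → g i ≤ Σ is g
∈⇒≤Σ g (here refl) = m≤m+n (g _) _
∈⇒≤Σ g (there i∈)  = ≤-trans (∈⇒≤Σ g i∈) (m≤n+m _ (g _))

-- The lower bound.

module LowerBound {k n}
  (edges       : List (Vec (Fin n) k))
  (edgesUnique : Unique edges)
  (noRepeats   : ∀ {e} → e ∈ edges → VecUnique.Unique e)
  (setsDiffer  : ∀ {e e′} → e ∈ edges → e′ ∈ edges → SameSet e e′ → e ≡ e′)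
  (propertyO   : (_<_ : Rel (Fin n) 0ℓ) → IsStrictTotalOrder _≡_ _<_ →
                 ∃[ e ] (e ∈ edges × Consistent _<_ e))
  where

  open Prefix (Fin._≟_ {n})
  open DecMembership (Fin._≟_ {n}) using (_∈?_)

  m : ℕ
  m = length edges

  edge : Fin m → List (Fin n)
  edge i = toList (lookup edges i)

  edge-within : Within (allFin m) (allFin n) edge
  edge-within i = toList-unique (noRepeats (∈-lookup i)) , λ {u} _ → ∈-allFin u

  total : List (Fin n) → ℕ
  total = W (allFin m) (const 1) edge

  total-[] : total [] ≡ m
  total-[] = trans (Σ-const (allFin m) 1) (trans (*-identityʳ _) (length-tabulate id))

  -- A prefix listing all vertices is a linear order; the edge that Property O supplies for it
  -- already has weight `k !`.
  bounded : Bounded (allFin m) {k !} (allFin n) (const 1) edge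
  bounded {p} all⊆p =
    let _<_ = Lex _<ℕ_ (position p)
        e , e∈ , e< = propertyO _<_ (Lex-isStrictTotalOrder <-isStrictTotalOrder (position p))
        i = Any.index e∈
        e≡ : e ≡ lookup edges i
        e≡ = Any.lookup-index e∈
        e<′ = toList-linked <-trans (Linked.map before e<)
    in begin
      k !                  ≡⟨ cong _! (Vec.length-toList e) ⟨
      length (toList e) !  ≡⟨ w-consistent p (toList-unique (noRepeats e∈)) (λ {u} _ → ∈p u) e<′ ⟨
      w (toList e) p       ≡⟨ cong (λ e → w (toList e) p) e≡ ⟩
      w (edge i) p         ≡⟨ *-identityˡ _ ⟨
      1 * w (edge i) p     ≤⟨ ∈⇒≤Σ (λ i → 1 * w (edge i) p) (∈-allFin i) ⟩
      total p              ∎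
    where
    open ≤-Reasoning
    ∈p : ∀ u → u ∈ p
    ∈p u = all⊆p (∈-allFin u)
    before : ∀ {u v} → Lex _<ℕ_ (position p) u v → Before p u v
    before (inj₁ u<v) = u<v
    -- Vertices of `p` with equal positions coincide, so the tie-break never decides.
    before {u} {v} (inj₂ (eq , u<v)) =
      contradiction (position-injective p (∈p u) (∈p v) eq) (Fin.<⇒≢ u<v)

  k!≤m : k ! ≤ m
  k!≤m = subst (k ! ≤_) total-[]
    (bounded-[] (allFin m) (const 1) edge (Unique.allFin⁺ n) edge-within bounded)

  module Tight (m≡k! : m ≡ k !) where

    total≡k! : ∀ q → Unique q → total q ≡ k !
    total≡k! q uq = W-tight (allFin m) (const 1) edge q (Unique.allFin⁺ n) edge-within bounded
      (trans total-[] m≡k!) uq (λ {u} _ → ∈-allFin u)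

    alt-total : ∀ x xs → Unique (x ∷ xs) → alt (x ∷ xs) (λ p → pos (total p)) ≡ 0ℤ
    alt-total x xs uxs = trans (alt-unique-cong uxs (λ p up _ → cong pos (total≡k! p up)))
                               (alt-const x xs (pos (k !)))

  -- Both edges have `k` distinct vertices, so inclusion would force equal vertex sets, hence equal
  -- edges.
  separating : ∀ {e f} → e ∈ edges → f ∈ edges → e ≢ f → ∃[ u ] (u ∈ toList e × u ∉ toList f)
  separating {e} {f} e∈ f∈ e≢f with All.all? (_∈? toList f) (toList e)
  ... | no ¬e⊆f = find (All.¬All⇒Any¬ (_∈? toList f) (toList e) ¬e⊆f)
  ... | yes e⊆f = contradiction (setsDiffer e∈ f∈ λ v → mk⇔
          (λ v∈ → Vec.∈-toList⁻ (All.lookup e⊆f (Vec.∈-toList⁺ v∈)))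
          (λ v∈ → Vec.∈-toList⁻ (f⊆e (Vec.∈-toList⁺ v∈))))
        e≢f
    where
    f⊆e : toList f ⊆ toList e
    f⊆e = unique-⊆⇒⊇ (toList-unique (noRepeats e∈)) (toList-unique (noRepeats f∈))
            (trans (Vec.length-toList e) (sym (Vec.length-toList f))) (All.lookup e⊆f)

module _ {n : ℕ} where

  open Prefix (Fin._≟_ {n})

  length≢k! : ∀ {k} → 2 ≤ k → (edges : List (Vec (Fin n) k)) →
    Unique edges →
    (∀ {e} → e ∈ edges → VecUnique.Unique e) →
    (∀ {e e′} → e ∈ edges → e′ ∈ edges → SameSet e e′ → e ≡ e′) →
    ((_<_ : Rel (Fin n) 0ℓ) → IsStrictTotalOrder _≡_ _<_ → ∃[ e ] (e ∈ edges × Consistent _<_ e)) →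
    length edges ≢ k !
  length≢k! {k} 2≤k [] _ _ _ _ m≡k! = contradiction (subst (1 ≤_) (sym m≡k!) (1≤n! k)) λ ()
  length≢k! (s≤s (s≤s _)) edges@(e@(x ∷ xs@(y ∷ ys)) ∷ es) uE@(e∉es ∷ _) noRepeats setsDiffer propertyO m≡k! =
    -- As `e` has at least two vertices, the right-hand side computes to a negative integer.
    contradiction 0≡1-k λ ()
    where
    open LowerBound edges uE noRepeats setsDiffer propertyO
    open Tight m≡k!
    open ≡-Reasoning
    ue : Unique (toList e)
    ue = toList-unique (noRepeats (here refl))
    rotated : List (Fin n)
    rotated = toList xs ++ [ x ]
    ∈-rotated : ∀ {u} → u ∈ toList e → u ∈ rotated
    ∈-rotated (here refl) = ∈-++⁺ʳ (toList xs) (here refl)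
    ∈-rotated (there u∈)  = ∈-++⁺ˡ u∈
    others : ∀ {i} → i ∈ tabulate suc → altw rotated (edge i) ≡ 0ℤ
    others i∈ with ∈-tabulate⁻ i∈
    ... | j , refl =
      let f∈ = ∈-lookup {xs = es} j
          u , u∈e , u∉f = separating (here refl) (there f∈) (All.lookup e∉es f∈)
      in altw-∉ (edge (suc j)) (∈-rotated u∈e) u∉f
    0≡1-k : 0ℤ ≡ pos 1 - pos (length (toList e))
    0≡1-k = begin
      0ℤ ≡⟨ alt-total y (toList ys ++ [ x ]) (rotate-unique ue) ⟨
      alt rotated (λ p → pos (total p))
        ≡⟨ altΣw-∷ rotated zero (tabulate suc) edge ⟩
      altw rotated (toList e) +ℤ alt rotated (λ p → pos (W (tabulate suc) (const 1) edge p))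
        ≡⟨ cong₂ _+ℤ_ (altw-rotate (toList xs) ue id) (altΣw-0 rotated (tabulate suc) edge others) ⟩
      (pos 1 - pos (length (toList e))) +ℤ 0ℤ
        ≡⟨ ℤ.+-identityʳ _ ⟩
      pos 1 - pos (length (toList e)) ∎

k!<size : ∀ {k} → 2 ≤ k → (H : OrientedGraph k) → PropertyO H → k ! < OrientedGraph.size H
k!<size 2≤k H propertyO = ≤∧≢⇒<
  (LowerBound.k!≤m edges edgesUnique noRepeats setsDiffer propertyO)
  (λ k!≡m → length≢k! 2≤k edges edgesUnique noRepeats setsDiffer propertyO (sym k!≡m))
  where open OrientedGraph H

-- Oriented graphs as images of indexed families.

map-unique : ∀ {A B : Set} {f : A → B} {xs} →
             (∀ {x y} → x ∈ xs → y ∈ xs → f x ≡ f y → x ≡ y) → Unique xs → Unique (map f xs)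
map-unique inj []         = []
map-unique inj (x∉ ∷ uxs) =
  All.map⁺ (All.tabulate (λ y∈ fx≡fy → All.lookup x∉ y∈ (inj (here refl) (there y∈) fx≡fy)))
  ∷ map-unique (λ x∈ y∈ → inj (there x∈) (there y∈)) uxs

Vec-map-unique : ∀ {A B : Set} {f : A → B} {n} {xs : Vec A n} →
                 (∀ {x y} → x Vec.∈ xs → y Vec.∈ xs → f x ≡ f y → x ≡ y) →
                 VecUnique.Unique xs → VecUnique.Unique (Vec.map f xs)
Vec-map-unique inj VecUnique.[]         = VecUnique.[]
Vec-map-unique {f = f} {xs = x ∷ xs} inj (x∉ VecUnique.∷ uxs) =
  VecAll.map⁺ (VecAll.lookup⁻ λ i fx≡fy → VecAll.lookup⁺ x∉ i
    (inj (VecAny.here refl) (VecAny.there (Vec.∈-lookup i xs)) fx≡fy))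
  VecUnique.∷ Vec-map-unique (λ x∈ y∈ → inj (VecAny.there x∈) (VecAny.there y∈)) uxs

Vec-∈-map⁻ : ∀ {A B : Set} {f : A → B} {n} {xs : Vec A n} {y} →
             y Vec.∈ Vec.map f xs → ∃[ x ] (x Vec.∈ xs × y ≡ f x)
Vec-∈-map⁻ {xs = x ∷ xs} (VecAny.here y≡)  = x , VecAny.here refl , y≡
Vec-∈-map⁻ {xs = x ∷ xs} (VecAny.there y∈) = let z , z∈ , y≡ = Vec-∈-map⁻ y∈ in z , VecAny.there z∈ , y≡

-- Injectivity is asked only on the entries of the two tuples, since a renaming may merge vertices
-- that lie in no edge.
SameSet-map⁻ : ∀ {n N k} {φ : Fin n → Fin N} {e e′ : Vec (Fin n) k} →
               (∀ {u v} → u Vec.∈ e → v Vec.∈ e′ → φ u ≡ φ v → u ≡ v) →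
               SameSet (Vec.map φ e) (Vec.map φ e′) → SameSet e e′
SameSet-map⁻ {φ = φ} {e} {e′} inj same v = mk⇔ to from
  where
  to : v Vec.∈ e → v Vec.∈ e′
  to v∈ = let u , u∈ , φv≡φu = Vec-∈-map⁻ (Equivalence.to (same (φ v)) (Vec.∈-map⁺ φ v∈))
          in subst (Vec._∈ e′) (sym (inj v∈ u∈ φv≡φu)) u∈
  from : v Vec.∈ e′ → v Vec.∈ e
  from v∈ = let u , u∈ , φv≡φu = Vec-∈-map⁻ (Equivalence.from (same (φ v)) (Vec.∈-map⁺ φ v∈))
            in subst (Vec._∈ e) (inj u∈ v∈ (sym φv≡φu)) u∈

linked-map-∈ : ∀ {A : Set} {R S : Rel A 0ℓ} {n} {xs : Vec A n} →
               (∀ {x y} → x Vec.∈ xs → y Vec.∈ xs → R x y → S x y) → Linked R xs → Linked S xs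
linked-map-∈ R⇒S []  = []
linked-map-∈ R⇒S [-] = [-]
linked-map-∈ {xs = x ∷ y ∷ _} R⇒S (Rxy ∷ Rxs) =
  R⇒S (VecAny.here refl) (VecAny.there (VecAny.here refl)) Rxy
  ∷ linked-map-∈ (λ x∈ y∈ → R⇒S (VecAny.there x∈) (VecAny.there y∈)) Rxs

-- Serves twice: for renaming the vertices of a given graph and for the upper-bound construction.
module Family {I : Set} {N k} (is : List I) (is! : Unique is) (edge : I → Vec (Fin N) k)
  (edge-unique    : ∀ {i} → i ∈ is → VecUnique.Unique (edge i))
  (edge-injective : ∀ {i j} → i ∈ is → j ∈ is → SameSet (edge i) (edge j) → i ≡ j)
  where

  graph : OrientedGraph k
  graph = record
    { order       = N
    ; edges       = map edge is
    ; edgesUnique = map-unique (λ i∈ j∈ eq → edge-injective i∈ j∈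
                      (λ v → mk⇔ (subst (v Vec.∈_) eq) (subst (v Vec.∈_) (sym eq)))) is!
    ; noRepeats   = λ e∈ → let i , i∈ , e≡ = ∈-map⁻ edge e∈ in subst VecUnique.Unique (sym e≡) (edge-unique i∈)
    ; setsDiffer  = differ
    }
    where
    differ : ∀ {e e′} → e ∈ map edge is → e′ ∈ map edge is → SameSet e e′ → e ≡ e′
    differ e∈ e′∈ same with ∈-map⁻ edge e∈ | ∈-map⁻ edge e′∈
    ... | i , i∈ , refl | j , j∈ , refl = cong edge (edge-injective i∈ j∈ same)

-- Reduction to a bounded vertex set.

module Compress {k} (H : OrientedGraph k) where

  open OrientedGraph H
  open Prefix (Fin._≟_ {order}) using (position; position-injective)

  -- Repetitions are kept, which makes the length exactly `size * k`.
  vertices : List (Fin order)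
  vertices = concat (map toList edges)

  ∈-vertices : ∀ {e v} → e ∈ edges → v Vec.∈ e → v ∈ vertices
  ∈-vertices e∈ v∈ = ∈-concat⁺′ (Vec.∈-toList⁺ v∈) (∈-map⁺ toList e∈)

  vertices-length : length vertices ≡ size * k
  vertices-length = go edges
    where
    go : ∀ es → length (concat (map toList es)) ≡ length es * k
    go []       = refl
    go (e ∷ es) = trans (length-++ (toList e)) (cong₂ _+_ (Vec.length-toList e) (go es))

  position≤length : ∀ p v → position p v ≤ length p
  position≤length []      v = z≤n
  position≤length (u ∷ p) v with u Fin.≟ v
  ... | yes _ = z≤n
  ... | no  _ = s≤s (position≤length p v)

  -- Vertices outside all edges share the default position `size * k`, hence the one extra name.
  rename : Fin order → Fin (suc (size * k))
  rename v = Fin.fromℕ< (s≤s (subst (position vertices v ≤_) vertices-length (position≤length vertices v)))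

  rename-injective : ∀ {u v} → u ∈ vertices → v ∈ vertices → rename u ≡ rename v → u ≡ v
  rename-injective u∈ v∈ eq = position-injective vertices u∈ v∈
    (trans (sym (Fin.toℕ-fromℕ< _)) (trans (cong Fin.toℕ eq) (Fin.toℕ-fromℕ< _)))

  open Family edges edgesUnique (Vec.map rename)
    (λ e∈ → Vec-map-unique (λ u∈ v∈ → rename-injective (∈-vertices e∈ u∈) (∈-vertices e∈ v∈)) (noRepeats e∈))
    (λ e∈ e′∈ same → setsDiffer e∈ e′∈
      (SameSet-map⁻ (λ u∈ v∈ → rename-injective (∈-vertices e∈ u∈) (∈-vertices e′∈ v∈)) same))
    public

  size-graph : OrientedGraph.size graph ≡ size
  size-graph = length-map (Vec.map rename) edges

  -- The order is pulled back along `rename`; ties do not matter because `rename` is injective on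
  -- the vertices of an edge.
  graph-propertyO : PropertyO H → PropertyO graph
  graph-propertyO propertyO _<_ sto =
    let e , e∈ , e< = propertyO (Lex _<_ rename) (Lex-isStrictTotalOrder sto rename)
    in Vec.map rename e , ∈-map⁺ (Vec.map rename) e∈ , Linked.map⁺ (linked-map-∈
      (λ { u∈ v∈ (inj₁ u<v)        → u<v
         ; u∈ v∈ (inj₂ (eq , u<v)) → contradiction (rename-injective (∈-vertices e∈ u∈) (∈-vertices e∈ v∈) eq)
                                       (Fin.<⇒≢ u<v) }) e<)

-- Decidability of having Property O with m edges.

allVecs : ∀ {A : Set} → List A → ∀ n → List (Vec A n)
allVecs xs zero    = [ [] ]
allVecs xs (suc n) = cartesianProductWith _∷_ xs (allVecs xs n)

∈-allVecs : ∀ {A : Set} {xs : List A} → (∀ x → x ∈ xs) → ∀ {n} (v : Vec A n) → v ∈ allVecs xs n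
∈-allVecs ∈xs []      = here refl
∈-allVecs ∈xs (x ∷ v) = ∈-cartesianProductWith⁺ _∷_ (∈xs x) (∈-allVecs ∈xs v)

module _ {n : ℕ} where

  private
    Keys : List (Vec (Fin (suc n)) n)
    Keys = allVecs (allFin (suc n)) n

  ByKey : Vec (Fin (suc n)) n → Rel (Fin n) 0ℓ
  ByKey key = Lex Fin._<_ (Vec.lookup key)

  -- Orders are represented by key vectors from a finite list, which turns the quantifier over all
  -- linear orders into a finite check.
  Valid : ∀ {k} → List (Vec (Fin n) k) → Set
  Valid es = Unique es
    × All VecUnique.Unique es
    × All (λ e → All (λ e′ → SameSet e e′ → e ≡ e′) es) es
    × All (λ key → Any (Consistent (ByKey key)) es) Keys

  sameSet? : ∀ {k} (e e′ : Vec (Fin n) k) → Dec (SameSet e e′)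
  sameSet? e e′ = Fin.all? λ v → map′ (λ (to , from) → mk⇔ to from)
      (λ e⇔e′ → Equivalence.to e⇔e′ , Equivalence.from e⇔e′)
    (((v ∈? e) →-dec (v ∈? e′)) ×-dec ((v ∈? e′) →-dec (v ∈? e)))
    where open VecDecMembership (Fin._≟_ {n}) using (_∈?_)

  valid? : ∀ {k} (es : List (Vec (Fin n) k)) → Dec (Valid es)
  valid? es = DecUnique.unique? _≟ᵛ_ es
    ×-dec All.all? (VecAllPairs.allPairs? λ u v → ¬? (u Fin.≟ v)) es
    ×-dec All.all? (λ e → All.all? (λ e′ → sameSet? e e′ →-dec (e ≟ᵛ e′)) es) es
    ×-dec All.all? (λ key → Any.any? (linked? (byKey? key)) es) Keys
    where
    _≟ᵛ_ : DecidableEquality (Vec (Fin n) _)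
    _≟ᵛ_ = Vec.≡-dec Fin._≟_
    byKey? : ∀ key → Decidable₂ (ByKey key)
    byKey? key u v = (Vec.lookup key u Fin.<? Vec.lookup key v)
      ⊎-dec ((Vec.lookup key u Fin.≟ Vec.lookup key v) ×-dec (u Fin.<? v))

  module Rank {_<_ : Rel (Fin n) 0ℓ} (sto : IsStrictTotalOrder _≡_ _<_) where

    open IsStrictTotalOrder sto using (compare; irrefl; _<?_) renaming (trans to <-transitive)

    -- The number of vertices below `u`, used as its key to recover an arbitrary order from a key
    -- vector.
    rank : Fin n → ℕ
    rank u = Σ (allFin n) (λ w → 𝟙 (w <? u))

    𝟙-mono : ∀ {u v} → u < v → ∀ w → 𝟙 (w <? u) ≤ 𝟙 (w <? v)
    𝟙-mono {u} {v} u<v w with w <? u | w <? v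
    ... | no _    | _      = z≤n
    ... | yes _   | yes _  = ≤-refl
    ... | yes w<u | no w≮v = contradiction (<-transitive w<u u<v) w≮v

    𝟙-strict : ∀ {u v} → u < v → 𝟙 (u <? u) <ℕ 𝟙 (u <? v)
    𝟙-strict {u} {v} u<v with u <? u | u <? v
    ... | no _    | yes _  = ≤-refl
    ... | yes u<u | _      = contradiction u<u (irrefl refl)
    ... | no _    | no u≮v = contradiction u<v u≮v

    Σ-strict : ∀ {is : List (Fin n)} {g h i} → (∀ j → g j ≤ h j) → i ∈ is → g i <ℕ h i → Σ is g <ℕ Σ is h
    Σ-strict {_ ∷ is} g≤h (here refl) gi<hi = +-mono-<-≤ gi<hi (Σ-mono is (λ {j} _ → g≤h j))
    Σ-strict g≤h (there i∈) gi<hi = +-mono-≤-< (g≤h _) (Σ-strict g≤h i∈ gi<hi)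

    -- Whatever is below `u` is below `v`, and `u` itself is counted only for `v`.
    rank-mono : ∀ {u v} → u < v → rank u <ℕ rank v
    rank-mono {u} u<v = Σ-strict (𝟙-mono u<v) (∈-allFin u) (𝟙-strict u<v)

    rank≤n : ∀ u → rank u ≤ n
    rank≤n u = begin
      rank u               ≤⟨ Σ-mono (allFin n) (λ {w} _ → 𝟙≤1 (w <? u)) ⟩
      Σ (allFin n) (const 1) ≡⟨ Σ-const (allFin n) 1 ⟩
      length (allFin n) * 1  ≡⟨ trans (*-identityʳ _) (length-tabulate id) ⟩
      n                      ∎
      where open ≤-Reasoning

    key : Vec (Fin (suc n)) n
    key = Vec.tabulate (λ u → Fin.fromℕ< (s≤s (rank≤n u)))

    toℕ-key : ∀ u → Fin.toℕ (Vec.lookup key u) ≡ rank u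
    toℕ-key u = trans (cong Fin.toℕ (Vec.lookup∘tabulate _ u)) (Fin.toℕ-fromℕ< _)

    -- If `v < u` held instead, `rank v` would be strictly smaller than `rank u`, against the keys.
    byKey⇒< : ∀ {u v} → ByKey key u v → u < v
    byKey⇒< {u} {v} u<v with compare u v
    ... | tri< u<′v _ _ = u<′v
    byKey⇒< {u} {v} (inj₁ lt)       | tri≈ _ refl _ = contradiction refl (Fin.<⇒≢ lt)
    byKey⇒< {u} {v} (inj₂ (_ , lt)) | tri≈ _ refl _ = contradiction refl (Fin.<⇒≢ lt)
    byKey⇒< {u} {v} u<v | tri> _ _ v<u = contradiction (rank≤ u<v) (<⇒≱ (rank-mono v<u))
      where
      rank≤ : ByKey key u v → rank u ≤ rank v
      rank≤ (inj₁ lt)       = <⇒≤ (subst₂ _<ℕ_ (toℕ-key u) (toℕ-key v) lt)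
      rank≤ (inj₂ (eq , _)) = ≤-reflexive (trans (sym (toℕ-key u)) (trans (cong Fin.toℕ eq) (toℕ-key v)))

  valid⇒propertyO : ∀ {k} {es : List (Vec (Fin n) k)} → Valid es → SizeWithPropertyO k (length es)
  valid⇒propertyO {es = es} (es! , noRepeats , differ , consistent) = record
    { order       = n
    ; edges       = es
    ; edgesUnique = es!
    ; noRepeats   = All.lookup noRepeats
    ; setsDiffer  = λ e∈ e′∈ → All.lookup (All.lookup differ e∈) e′∈
    } , refl , λ _<_ sto →
      let open Rank sto
          e , e∈ , e< = find (All.lookup consistent (∈-allVecs ∈-allFin key))
      in e , e∈ , Linked.map byKey⇒< e<

propertyO⇒valid : ∀ {k} (H : OrientedGraph k) → PropertyO H → Valid (OrientedGraph.edges H)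
propertyO⇒valid H propertyO =
  edgesUnique , All.tabulate noRepeats ,
  All.tabulate (λ e∈ → All.tabulate (setsDiffer e∈)) ,
  All.tabulate (λ {key} _ →
    let e , e∈ , e< = propertyO (ByKey key) (Lex-isStrictTotalOrder Fin.<-isStrictTotalOrder (Vec.lookup key))
    in lose e∈ e<)
  where open OrientedGraph H

-- By `Compress`, a graph with `m` edges can be sought on `suc (m * k)` vertices, so there are
-- finitely many candidates.
size? : ∀ k m → Dec (SizeWithPropertyO k m)
size? k m = map′ to from (Any.any? (valid? ∘ toList) candidates)
  where
  candidates : List (Vec (Vec (Fin (suc (m * k))) k) m)
  candidates = allVecs (allVecs (allFin _) k) m
  to : Any (Valid ∘ toList) candidates → SizeWithPropertyO k m
  to p = let E , _ , valid = find p in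
    subst (SizeWithPropertyO k) (Vec.length-toList E) (valid⇒propertyO valid)
  from : SizeWithPropertyO k m → Any (Valid ∘ toList) candidates
  from (H , refl , propertyO) = lose
    (∈-allVecs (∈-allVecs ∈-allFin) (Vec.cast size-graph (fromList (OrientedGraph.edges graph))))
    (subst Valid (sym (trans (Vec.toList-cast size-graph _) (Vec.toList∘fromList _)))
      (propertyO⇒valid graph (graph-propertyO propertyO)))
    where open Compress H

-- Upward search from 0: `d` is the distance left to the known witness `b`, and the invariant
-- `lower` says that nothing below `m` satisfies `P`.
least : ∀ {ℓ} {P : ℕ → Set ℓ} → (∀ m → Dec (P m)) → ∀ {b} → P b → ∃[ m ] (IsMin P m)
least {P = P} P? {b} Pb = search b 0 (+-identityʳ b) (λ _ → z≤n)
  where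
  search : ∀ d m → d + m ≡ b → (∀ {m′} → P m′ → m ≤ m′) → ∃[ m ] (IsMin P m)
  search d m eq lower with P? m
  ... | yes Pm = m , Pm , lower
  search zero    m refl lower | no ¬Pm = contradiction Pb ¬Pm
  search (suc d) m eq   lower | no ¬Pm = search d (suc m) (trans (+-suc d m) eq)
    (λ Pm′ → ≤∧≢⇒< (lower Pm′) (λ { refl → ¬Pm Pm′ }))

-- Insertion, replacement and permutations of vectors.

private
  variable
    A : Set
    P : A → Set
    n : ℕ
    b x : A
    xs : Vec A n

All-insertAt : VecAll.All P xs → ∀ i → P x → VecAll.All P (insertAt xs i x)
All-insertAt Pxs        zero    Px = Px ∷ Pxs
All-insertAt (Py ∷ Pxs) (suc i) Px = Py ∷ All-insertAt Pxs i Px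

All-[]≔ : VecAll.All P xs → ∀ i → P b → VecAll.All P (xs [ i ]≔ b)
All-[]≔ (_  ∷ Pxs) zero    Pb = Pb ∷ Pxs
All-[]≔ (Px ∷ Pxs) (suc i) Pb = Px ∷ All-[]≔ Pxs i Pb

insertAt-unique : VecUnique.Unique xs → ∀ i → VecAll.All (x ≢_) xs → VecUnique.Unique (insertAt xs i x)
insertAt-unique uxs        zero    x∉         = x∉ ∷ uxs
insertAt-unique (y∉ ∷ uxs) (suc i) (x≢y ∷ x∉) = All-insertAt y∉ i (x≢y ∘ sym) ∷ insertAt-unique uxs i x∉

[]≔-unique : VecUnique.Unique xs → ∀ i → VecAll.All (b ≢_) xs → VecUnique.Unique (xs [ i ]≔ b)
[]≔-unique (_  ∷ uxs) zero    (_ ∷ b∉)   = b∉ ∷ uxs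
[]≔-unique (x∉ ∷ uxs) (suc i) (b≢x ∷ b∉) = All-[]≔ x∉ i (b≢x ∘ sym) ∷ []≔-unique uxs i b∉

∈-insertAt : ∀ (xs : Vec A n) i x → x Vec.∈ insertAt xs i x
∈-insertAt xs i x = subst (Vec._∈ insertAt xs i x) (Vec.insertAt-lookup xs i x) (Vec.∈-lookup i _)

∈-[]≔ : ∀ (xs : Vec A n) i b → b Vec.∈ xs [ i ]≔ b
∈-[]≔ xs i b = subst (Vec._∈ xs [ i ]≔ b) (Vec.lookup∘update i xs b) (Vec.∈-lookup i _)

lookup-∈-[]≔ : ∀ (xs : Vec A n) {i j} b → i ≢ j → Vec.lookup xs i Vec.∈ xs [ j ]≔ b
lookup-∈-[]≔ xs {i} {j} b i≢j =
  subst (Vec._∈ xs [ j ]≔ b) (Vec.lookup∘update′ i≢j xs b) (Vec.∈-lookup i _)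

lookup-∉-[]≔ : VecUnique.Unique xs → VecAll.All (b ≢_) xs → ∀ i → ¬ Vec.lookup xs i Vec.∈ xs [ i ]≔ b
lookup-∉-[]≔ (x∉ ∷ _) (b≢x ∷ _) zero (VecAny.here x≡b)  = b≢x (sym x≡b)
lookup-∉-[]≔ (x∉ ∷ _) (b≢x ∷ _) zero (VecAny.there x∈)  = VecAll.lookup x∉ x∈ refl
lookup-∉-[]≔ (x∉ ∷ _) _ (suc i) (VecAny.here eq) = VecAll.lookup x∉ (Vec.∈-lookup i _) (sym eq)
lookup-∉-[]≔ (_ ∷ uxs) (_ ∷ b∉) (suc i) (VecAny.there y∈) = lookup-∉-[]≔ uxs b∉ i y∈

-- The index is read in the factorial number system: its leading digit is the place of the head, the
-- rest permutes the tail.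
perm : ∀ {n} → Vec A n → Fin (n !) → Vec A n
perm                 []       c = []
perm {n = suc n} (x ∷ xs) c =
  insertAt (perm xs (proj₂ (remQuot {suc n} (n !) c))) (proj₁ (remQuot {suc n} (n !) c)) x

perm-All : VecAll.All P xs → ∀ c → VecAll.All P (perm xs c)
perm-All []         c = []
perm-All (Px ∷ Pxs) c = All-insertAt (perm-All Pxs _) _ Px

perm-unique : VecUnique.Unique xs → ∀ c → VecUnique.Unique (perm xs c)
perm-unique []         c = []
perm-unique (x∉ ∷ uxs) c = insertAt-unique (perm-unique uxs _) _ (perm-All x∉ _)

-- Replacing the entry in one of the slots 0, 2, 4, … or the last one suffices
-- to fit a new element anywhere into an increasing sequence.
slot : ∀ n → Fin (suc ⌊ suc n /2⌋) → Fin (suc n)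
slot zero          t       = zero
slot (suc zero)    t       = t
slot (suc (suc n)) zero    = zero
slot (suc (suc n)) (suc t) = suc (suc (slot n t))

slot-injective : ∀ n {s t} → slot n s ≡ slot n t → s ≡ t
slot-injective zero          {zero}  {zero}  eq = refl
slot-injective (suc zero)                    eq = eq
slot-injective (suc (suc n)) {zero}  {zero}  eq = refl
slot-injective (suc (suc n)) {suc s} {suc t} eq =
  cong suc (slot-injective n (Fin.suc-injective (Fin.suc-injective eq)))

-- Fitting elements into increasing sequences.

module Sorting {A : Set} {_<_ : Rel A 0ℓ} (sto : IsStrictTotalOrder _≡_ _<_) where

  open IsStrictTotalOrder sto using (compare) renaming (trans to <-transitive)

  Sorted : ∀ {n} → Vec A n → Set
  Sorted = VecAllPairs.AllPairs _<_

  sorted⇒linked : ∀ {n} {xs : Vec A n} → Sorted xs → Linked _<_ xs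
  sorted⇒linked []                      = []
  sorted⇒linked (_ ∷ [])                = [-]
  sorted⇒linked ((x<y ∷ _) ∷ s@(_ ∷ _)) = x<y ∷ sorted⇒linked s

  sort-insertAt : ∀ {n x} {xs : Vec A n} → Sorted xs → VecAll.All (x ≢_) xs → ∃[ i ] Sorted (insertAt xs i x)
  sort-insertAt []             _          = zero , [] ∷ []
  sort-insertAt {x = x} {y ∷ ys} (y< ∷ s) (x≢y ∷ x∉) with compare x y
  ... | tri< x<y _ _ = zero , (x<y ∷ VecAll.map (<-transitive x<y) y<) ∷ y< ∷ s
  ... | tri≈ _ x≡y _ = contradiction x≡y x≢y
  ... | tri> _ _ y<x = let i , s′ = sort-insertAt s x∉ in suc i , All-insertAt y< i y<x ∷ s′

  -- Insertion sort, with the insertion places as digits of the index.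
  sort-perm : ∀ {n} {xs : Vec A n} → VecUnique.Unique xs → ∃[ c ] Sorted (perm xs c)
  sort-perm []         = zero , []
  sort-perm {suc n} {x ∷ xs} (x∉ ∷ uxs) =
    let c , s  = sort-perm uxs
        i , s′ = sort-insertAt s (perm-All x∉ c)
    in combine i c , subst (λ q → Sorted (insertAt (perm xs (proj₂ q)) (proj₁ q) x))
                           (sym (Fin.remQuot-combine i c)) s′

  -- Compare `b` with the second entry: if smaller, it can replace the first; if larger, the first
  -- two entries stay and the search moves on by two, until at most two entries remain.
  sort-slot : ∀ n {b} {xs : Vec A (suc n)} → Sorted xs → VecAll.All (b ≢_) xs →
              ∃[ t ] Sorted (xs [ slot n t ]≔ b)
  sort-slot zero       {xs = _ ∷ []}     _ _ = zero , [] ∷ []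
  sort-slot (suc zero) {b} {x ∷ y ∷ []} ((x<y ∷ []) ∷ _) (_ ∷ b≢y ∷ []) with compare b y
  ... | tri< b<y _ _ = zero , (b<y ∷ []) ∷ [] ∷ []
  ... | tri≈ _ b≡y _ = contradiction b≡y b≢y
  ... | tri> _ _ y<b = suc zero , (<-transitive x<y y<b ∷ []) ∷ [] ∷ []
  sort-slot (suc (suc n)) {b} {x ∷ y ∷ _} ((x<y ∷ x<) ∷ y< ∷ s) (_ ∷ b≢y ∷ b∉) with compare b y
  ... | tri< b<y _ _ = zero , (b<y ∷ VecAll.map (<-transitive b<y) y<) ∷ y< ∷ s
  ... | tri≈ _ b≡y _ = contradiction b≡y b≢y
  ... | tri> _ _ y<b =
    let t , s′ = sort-slot n s b∉ in
    suc t , (x<y ∷ All-[]≔ x< (slot n t) (<-transitive x<y y<b)) ∷ All-[]≔ y< (slot n t) y<b ∷ s′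

-- The upper-bound construction.

Vertex : ℕ → Set
Vertex n = Fin n ⊎ (Fin (n !) ⊎ (Fin (n !) × Fin n))

vertex↔ : ∀ n → Fin (n + (n ! + n ! * n)) ↔ Vertex n
vertex↔ n = ↔-trans Fin.+↔⊎ (↔-refl ⊎-↔ ↔-trans Fin.+↔⊎ (↔-refl ⊎-↔ Fin.*↔×))

-- With an injective `code`, distinctness of vertices reduces to the constructors of `Vertex`.
module UpperBound {n N} (code : Vertex n → Fin N) (code-injective : ∀ {u v} → code u ≡ code v → u ≡ v) where

  h : ℕ
  h = ⌊ suc n /2⌋

  V : Set
  V = Fin N

  Index : Set
  Index = Fin (n !) × (Fin 1 ⊎ (Fin n × Fin (suc h)))

  index↔ : Fin (n ! * (1 + n * suc h)) ↔ Index
  index↔ = ↔-trans Fin.*↔× (↔-refl ×-↔ ↔-trans Fin.+↔⊎ (↔-refl ⊎-↔ Fin.*↔×))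

  base : Fin n → V
  base i = code (inj₁ i)

  pivot : Fin (n !) → V
  pivot c = code (inj₂ (inj₁ c))

  filler : Fin (n !) → Fin n → V
  filler c j = code (inj₂ (inj₂ (c , j)))

  bases : Vec V n
  bases = Vec.tabulate base

  bases-unique : VecUnique.Unique bases
  bases-unique = VecUnique.tabulate⁺ (λ eq → case code-injective eq of λ { refl → refl })

  chain : Fin (n !) → Fin (suc n) → Vec V (suc n)
  chain c g = insertAt (perm bases c) g (pivot c)

  pivot∉perm : ∀ c → VecAll.All (pivot c ≢_) (perm bases c)
  pivot∉perm c = perm-All (VecAll.tabulate⁺ (λ i eq → case code-injective eq of λ ())) c

  chain-unique : ∀ c g → VecUnique.Unique (chain c g)
  chain-unique c g = insertAt-unique (perm-unique bases-unique c) g (pivot∉perm c)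

  chain-All : ∀ {P : V → Set} → (∀ i → P (base i)) → ∀ {c} → P (pivot c) → ∀ g → VecAll.All P (chain c g)
  chain-All Pbase {c} Ppivot g = All-insertAt (perm-All (VecAll.tabulate⁺ Pbase) c) g Ppivot

  filler∉chain : ∀ c j c′ g → VecAll.All (filler c j ≢_) (chain c′ g)
  filler∉chain c j c′ = chain-All (λ i eq → case code-injective eq of λ ()) (λ eq → case code-injective eq of λ ())

  edge : Index → Vec V (suc n)
  edge (c , inj₁ _)       = chain c zero
  edge (c , inj₂ (j , t)) = chain c (suc j) [ slot n t ]≔ filler c j

  edge-unique : ∀ i → VecUnique.Unique (edge i)
  edge-unique (c , inj₁ _)       = chain-unique c zero
  edge-unique (c , inj₂ (j , t)) =
    []≔-unique (chain-unique c (suc j)) (slot n t) (filler∉chain c j c (suc j))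

  pivot∈chain⁻ : ∀ {c c′ g} → pivot c Vec.∈ chain c′ g → c ≡ c′
  pivot∈chain⁻ {c} {c′} {g} v∈ = VecAll.lookup
    (chain-All {P = λ u → pivot c ≡ u → c ≡ c′}
      (λ i eq → case code-injective eq of λ ()) (λ eq → case code-injective eq of λ { refl → refl }) g)
    v∈ refl

  filler∈edge⁻ : ∀ {c j c′ j′ t} → filler c j Vec.∈ edge (c′ , inj₂ (j′ , t)) → (c , j) ≡ (c′ , j′)
  filler∈edge⁻ {c} {j} {c′} {j′} {t} f∈ = VecAll.lookup
    (All-[]≔ {P = λ u → filler c j ≡ u → (c , j) ≡ (c′ , j′)}
      (VecAll.map (λ f≢u f≡u → contradiction f≡u f≢u) (filler∉chain c j c′ (suc j′))) (slot n t)
      (λ eq → case code-injective eq of λ { refl → refl })) f∈ refl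

  -- A filler tells the two kinds of edge apart and determines `c` and `j`; a pivot determines `c`
  -- in the first kind. The remaining slot is determined by which chain entry is missing.
  edge-injective : ∀ i i′ → SameSet (edge i) (edge i′) → i ≡ i′
  edge-injective (c , inj₁ zero) (c′ , inj₁ zero) same =
    cong (_, inj₁ zero) (pivot∈chain⁻ {g = zero}
      (Equivalence.to (same (pivot c)) (∈-insertAt (perm bases c) zero (pivot c))))
  edge-injective (c , inj₁ _) (c′ , inj₂ (j , t)) same =
    contradiction refl (VecAll.lookup (filler∉chain c′ j c zero)
      (Equivalence.from (same (filler c′ j)) (∈-[]≔ (chain c′ (suc j)) (slot n t) (filler c′ j))))
  edge-injective (c , inj₂ (j , t)) (c′ , inj₁ _) same =
    contradiction refl (VecAll.lookup (filler∉chain c j c′ zero)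
      (Equivalence.to (same (filler c j)) (∈-[]≔ (chain c (suc j)) (slot n t) (filler c j))))
  edge-injective (c , inj₂ (j , t)) (c′ , inj₂ (j′ , t′)) same
    with filler∈edge⁻ {t = t′} (Equivalence.to (same (filler c j)) (∈-[]≔ (chain c (suc j)) (slot n t) (filler c j)))
  ... | refl with t Fin.≟ t′
  ...   | yes refl = refl
  -- The chain entry in slot `t′` survives in the first edge and is overwritten in the second.
  ...   | no t≢t′  = contradiction
    (Equivalence.to (same _) (lookup-∈-[]≔ (chain c (suc j)) (filler c j) (t≢t′ ∘ sym ∘ slot-injective n)))
    (lookup-∉-[]≔ (chain-unique c (suc j)) (filler∉chain c j c (suc j)) (slot n t′))

  -- Sorting the base vertices selects `c`; the sorted place of the pivot selects the kind of edge
  -- and `j`; the place of the filler selects the slot.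
  consistent-edge : ∀ {_<_ : Rel V 0ℓ} → IsStrictTotalOrder _≡_ _<_ → ∃[ i ] Consistent _<_ (edge i)
  consistent-edge sto with Sorting.sort-perm sto bases-unique
  ... | c , s with Sorting.sort-insertAt sto s (pivot∉perm c)
  ...   | zero  , s′ = (c , inj₁ zero) , Sorting.sorted⇒linked sto s′
  ...   | suc j , s′ with Sorting.sort-slot sto n s′ (filler∉chain c j c (suc j))
  ...     | t , s″ = (c , inj₂ (j , t)) , Sorting.sorted⇒linked sto s″

  open Family (allFin (n ! * (1 + n * suc h))) (Unique.allFin⁺ _) (edge ∘ Inverse.to index↔)
    (λ {i} _ → edge-unique (Inverse.to index↔ i))
    (λ {i} {i′} _ _ same → Injection.injective (↔⇒↣ index↔)
      (edge-injective (Inverse.to index↔ i) (Inverse.to index↔ i′) same))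
    public

  graph-propertyO : PropertyO graph
  graph-propertyO _<_ sto =
    let i , e< = consistent-edge sto
        i′ = Inverse.from index↔ i
    in edge (Inverse.to index↔ i′) , ∈-map⁺ (edge ∘ Inverse.to index↔) (∈-allFin i′) ,
       subst (Consistent _<_ ∘ edge) (sym (Inverse.strictlyInverseˡ index↔ i)) e<

  size-family : OrientedGraph.size graph ≡ n ! * (1 + n * suc h)
  size-family = trans (length-map (edge ∘ Inverse.to index↔) (allFin (n ! * (1 + n * suc h))))
                      (length-tabulate {n = n ! * (1 + n * suc h)} id)

  size-graph : OrientedGraph.size graph ≡ (h + 1) * suc n ! ∸ h * n !
  size-graph = begin
    OrientedGraph.size graph                       ≡⟨ size-family ⟩
    -- Adding `h * n !` before removing it keeps the truncated subtraction exact.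
    n ! * (1 + n * suc h)                          ≡⟨ m+n∸n≡m _ (h * n !) ⟨
    n ! * (1 + n * suc h) + h * n ! ∸ h * n !      ≡⟨ cong (_∸ h * n !) (count (n !) n h) ⟨
    (h + 1) * suc n ! ∸ h * n !                    ∎
    where
    open ≡-Reasoning
    count : ∀ F n h → (h + 1) * (suc n * F) ≡ F * (1 + n * suc h) + h * F
    count = ℕSolver.solve-∀

-- Existence of the minimum together with both bounds.

theorem1p3 : ∀ (k : ℕ) → 3 ≤ k →
    ∃[ m ] ((k f≔ m)
    × (k ! + 1 ≤ m)
    × (m ≤ (⌊ k /2⌋ + 1) * k ! ∸ ⌊ k /2⌋ * (k ∸ 1) !))
theorem1p3 k@(suc n) 3≤k =
  let open UpperBound (Inverse.from (vertex↔ n)) (Injection.injective (↔⇒↣ (↔-sym (vertex↔ n))))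
      -- The constructed graph also supplies the witness at which the search for the minimum must
      -- stop.
      m , isMin@((H , size≡m , propertyO) , minimal) = least (size? k) (graph , refl , graph-propertyO)
  in m , isMin
   , subst₂ _≤_ (+-comm 1 (k !)) size≡m (k!<size (≤-trans (n≤1+n 2) 3≤k) H propertyO)
   , subst (m ≤_) size-graph (minimal (graph , refl , graph-propertyO))
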